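{- Let $q$ be a power of a prime $p$ and let $r,s$ be positive integers with $s\equiv r+3\pmod{q+1}$. Let $B(x)\in\mathbb{F}_{q^2}[x]$ be such that $B(x)$ has no root in $\mu_{q+1}$ and $x\mapsto x^{r}B^{(q)}(1/x)/B(x)$ permutes $\mu_{q+1}$. Let $a\in\mathbb{F}_{q^2}\setminus\mathbb{F}_q$. Then $$x^{s}B(x^{q-1})\left(ax^{3(q-1)}+a^{q}\right)$$ permutes $\mathbb{F}_{q^2}$ if and only if $\gcd(s,q-1)=1$ and $-a^{q-1}\notin\mu_{\frac{q+1}{\gcd(q+1,3)}}$.
   Context: For a positive integer $d$ dividing $q+1$, $\mu_{d}$ denotes the set of $d$-th roots of unity in $\mathbb{F}_{q^2}$. For $B(x)\in\mathbb{F}_{q^2}[x]$, $B^{(q)}(x)$ denotes the polynomial obtained from $B(x)$ by raising every coefficient to the $q$-th power. A polynomial permutes a finite set if it induces a bijection of that set onto itself. -}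

module Defs where

open import Algebra.Bundles using (CommutativeRing)
open import Algebra.Definitions using (Invertible)
import Algebra.Properties.Semiring.Exp as Exp
open import Data.Fin.Base using (Fin)
open import Data.List.Base using (List; []; _∷_; map)
open import Data.Nat.Base using (ℕ; suc; NonZero; ≢-nonZero)
open import Data.Nat.GCD using (gcd; gcd[m,n]≢0)
open import Data.Product.Base using (Σ; _,_; proj₁)
open import Data.Sum.Base using (inj₁)
open import Function.Base using (_on_)
open import Function.Bundles using (Inverse)
open import Function.Definitions using (Bijective)
open import Level using (Level; _⊔_) renaming (suc to lsuc)
open import Relation.Binary.PropositionalEquality.Properties using (setoid)
open import Relation.Unary using (Pred; _∈_)

-- A field with exactly n elements, counted up to the ring's equality _≈_.
record FiniteField (c ℓ : Level) (n : ℕ) : Set (lsuc (c ⊔ ℓ)) where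
  field
    commutativeRing : CommutativeRing c ℓ

  open CommutativeRing commutativeRing public
    renaming (setoid to carrierSetoid)

  field
    1≉0         : 1# ≉ 0#
    invertible  : ∀ x → x ≉ 0# → Invertible _≈_ 1# _*_ x
    enumeration : Inverse (setoid (Fin n)) carrierSetoid

  open Exp semiring public using (_^_)

  inv : ∀ x → x ≉ 0# → Carrier
  inv x x≉0 = proj₁ (invertible x x≉0)

  μ : ℕ → Pred Carrier ℓ
  μ d x = x ^ d ≈ 1#

  μ⇒≉0 : ∀ {n x} → x ∈ μ (suc n) → x ≉ 0#
  μ⇒≉0 x∈μ x≈0 = 1≉0 (trans (sym x∈μ) (trans (*-congʳ x≈0) (zeroˡ _)))

  -- f is only required to be defined on S.
  Permutes : ∀ {p} (S : Pred Carrier p) → (Σ Carrier S → Carrier) → Set (c ⊔ ℓ ⊔ p)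
  Permutes S f = Σ (∀ x → f x ∈ S) λ closed →
    Bijective {A = Σ Carrier S} {B = Σ Carrier S} (_≈_ on proj₁) (_≈_ on proj₁)
      (λ x → f x , closed x)

  -- Coefficients in order of increasing degree; trailing zeros are allowed.
  Polynomial : Set c
  Polynomial = List Carrier

  eval : Polynomial → Carrier → Carrier
  eval []       x = 0#
  eval (b ∷ bs) x = b + x * eval bs x

  _⁽_⁾ : Polynomial → ℕ → Polynomial
  B ⁽ q ⁾ = map (_^ q) B

  NoRootIn : ∀ {p} → Pred Carrier p → Polynomial → Set (c ⊔ ℓ ⊔ p)
  NoRootIn S B = ∀ {x} → x ∈ S → eval B x ≉ 0#

  -- x ↦ x^r · B^(q)(1/x) / B(x) on μ_{q+1}.
  quotientMap : ∀ q (r : ℕ) (B : Polynomial) → NoRootIn (μ (suc q)) B →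
                Σ Carrier (μ (suc q)) → Carrier
  quotientMap q r B noRoot (x , x∈μ) =
    x ^ r * eval (B ⁽ q ⁾) (inv x (μ⇒≉0 {q} x∈μ)) * inv (eval B x) (noRoot x∈μ)

gcd-nonZero : ∀ m n → NonZero (gcd (suc m) n)
gcd-nonZero m n = ≢-nonZero (gcd[m,n]≢0 (suc m) n (inj₁ λ ()))

module Submission where

-- Put y = x^(q-1), which lies in μ_{q+1} when x ≠ 0, so that f(x) = x^s h(y)
-- with h(y) = B(y) (a y³ + a^q). Since y^q = 1/y, the Frobenius map x ↦ x^q
-- gives f(x)^q = f(x) φ(y), where φ(y) = y^r B^(q)(1/y) / B(y): it sends the
-- cubic factor to itself divided by y³, and y^s = y^(r+3). If the cubic factor
-- has no root in μ_{q+1}, then f(x) determines φ(y), hence y, hence x^s, and x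
-- is recovered from x^s and x^(q-1) when gcd(s, q-1) = 1. Conversely, a root y
-- of the cubic factor makes f vanish at some x ≠ 0, and a nontrivial root of
-- unity u of order dividing gcd(s, q-1) satisfies f(u) = f(1).

open import Defs
open import Algebra.Morphism.Structures using (module RingMorphisms)
open import Data.Nat as ℕ using (ℕ; zero; suc; _<_; _≤_; _∸_; _%_; _/_; s≤s; z≤n)
import Data.Nat.Properties as ℕₚ
import Data.Nat.Solver as ℕSolver
open import Data.Nat.Combinatorics using (_C_; nCn≡1; nC1≡n; nCk+nC[k+1]≡[n+1]C[k+1])
open import Data.Nat.Divisibility
  using (_∣_; divides; ∣⇒≤; ∣-refl; ∣-antisym; ∣-trans; n∣m*n)
open import Data.Nat.DivMod using (m≡m%n+[m/n]*n; m%n<n; m/n*n≡m)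
open import Data.Nat.GCD
  using (gcd; gcd[m,n]∣m; gcd[m,n]∣n; gcd-greatest; gcd[m,n]≢0; gcd-GCD; GCD; module Bézout)
open import Data.Nat.Primality using (Prime; euclidsLemma; ¬prime[0]; prime⇒nonTrivial)
open import Data.Fin.Base as Fin using (Fin; punchIn)
import Data.Fin.Properties as Finₚ
open import Data.Fin.Permutation using (Permutation; permutation; remove; punchIn-permute; _⟨$⟩ʳ_)
open import Data.List.Base using ([]; _∷_)
open import Data.Product using (_×_; _,_; ∃; proj₁; proj₂)
open import Data.Sum using (inj₁; inj₂)
open import Function.Base using (_∘_)
open import Level using (_⊔_)
open import Function.Bundles using (_⇔_; mk⇔; Inverse)
open import Function.Definitions using (Bijective)
open import Relation.Binary.PropositionalEquality as ≡ using (_≡_; _≢_)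
open import Relation.Nullary using (Dec; yes; no; contradiction)
open import Relation.Nullary.Decidable using (map′; decidable-stable; ¬?)
open import Relation.Unary using (_∉_)
import Algebra.Properties.CommutativeMonoid.Sum as Sum
import Algebra.Properties.CommutativeSemiring.Binomial as Binomial
import Algebra.Properties.CommutativeSemiring.Exp as Exp
import Algebra.Properties.Semiring.Mult as Mult
import Algebra.Properties.Ring as RingProperties
import Algebra.Solver.Ring.NaturalCoefficients.Default as Solver
import Relation.Binary.Reasoning.Setoid as SetoidReasoning

-- Divisibility of binomial coefficients by a prime

-- Induction through Pascal's rule. The product form of C(n+1,k+1) = (n+1)/(k+1) · C(n,k) avoids
-- division and exposes the factor n+1.
C-absorption : ∀ n k → suc k ℕ.* (suc n C suc k) ≡ suc n ℕ.* (n C k)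
C-absorption n zero = begin
  1 ℕ.* (suc n C 1)  ≡⟨ ≡.cong (1 ℕ.*_) (nC1≡n (suc n)) ⟩
  1 ℕ.* suc n        ≡⟨ ℕₚ.*-comm 1 (suc n) ⟩
  suc n ℕ.* 1        ≡⟨⟩
  suc n ℕ.* (n C 0)  ∎
  where open ≡.≡-Reasoning
C-absorption zero (suc k) = ℕₚ.*-zeroʳ (suc (suc k))
C-absorption (suc n) (suc k) = begin
  k+2 ℕ.* (suc (suc n) C k+2)
    ≡⟨ ≡.cong (k+2 ℕ.*_) (nCk+nC[k+1]≡[n+1]C[k+1] (suc n) (suc k)) ⟨
  k+2 ℕ.* ((suc n C suc k) ℕ.+ (suc n C k+2))
    ≡⟨ solve 3 (λ j x y → (con 1 :+ j) :* (x :+ y) := x :+ (j :* x :+ (con 1 :+ j) :* y)) ≡.refl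
         (suc k) (suc n C suc k) (suc n C k+2) ⟩
  (suc n C suc k) ℕ.+ (suc k ℕ.* (suc n C suc k) ℕ.+ k+2 ℕ.* (suc n C k+2))
    ≡⟨ ≡.cong ((suc n C suc k) ℕ.+_) (≡.cong₂ ℕ._+_ (C-absorption n k) (C-absorption n (suc k))) ⟩
  (suc n C suc k) ℕ.+ (suc n ℕ.* (n C k) ℕ.+ suc n ℕ.* (n C suc k))
    ≡⟨ ≡.cong ((suc n C suc k) ℕ.+_) (ℕₚ.*-distribˡ-+ (suc n) (n C k) (n C suc k)) ⟨
  (suc n C suc k) ℕ.+ suc n ℕ.* ((n C k) ℕ.+ (n C suc k))
    ≡⟨ ≡.cong (λ c → (suc n C suc k) ℕ.+ suc n ℕ.* c) (nCk+nC[k+1]≡[n+1]C[k+1] n k) ⟩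
  suc (suc n) ℕ.* (suc n C suc k) ∎
  where
  open ≡.≡-Reasoning
  open ℕSolver.+-*-Solver
  k+2 = suc (suc k)

-- Absorption makes the prime `suc p` divide `suc k` times the coefficient, and `suc k` is positive
-- and too small to be divisible by it.
prime∣C : ∀ {p k} → Prime (suc p) → suc k < suc p → suc p ∣ suc p C suc k
prime∣C {p} {k} p-prime k<p
  with euclidsLemma (suc k) (suc p C suc k) p-prime
         (divides (p C k) (≡.trans (C-absorption p k) (ℕₚ.*-comm (suc p) (p C k))))
... | inj₁ p∣k = contradiction (∣⇒≤ p∣k) (ℕₚ.<⇒≱ k<p)
... | inj₂ p∣C = p∣C

-- Finite fields: enumeration, cancellation and powers

module FieldTheory {c ℓ N} (F : FiniteField c ℓ (suc N)) where

  open FiniteField F public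
  open Exp commutativeSemiring public
    using (^-congˡ; ^-congʳ; ^-homo-*; ^-assocʳ; ^-distrib-*)
  open RingProperties ring public
    using (+-identityˡ-unique; +-identityʳ-unique; +-inverseˡ-unique; x∙y⁻¹≈ε⇒x≈y)
  open Mult semiring using (×1-homo-*; ×-congʳ; ×-congˡ; ×-assoc-*; ×-homo-1)
    renaming (_×_ to _×ₙ_)
  open SetoidReasoning carrierSetoid

  private module S = Solver commutativeSemiring

  element : Fin (suc N) → Carrier
  element = Inverse.to enumeration

  index : Carrier → Fin (suc N)
  index = Inverse.from enumeration

  index-cong : ∀ {x y} → x ≈ y → index x ≡ index y
  index-cong = Inverse.from-cong enumeration

  element-index : ∀ x → element (index x) ≈ x
  element-index = Inverse.strictlyInverseˡ enumeration

  index-element : ∀ i → index (element i) ≡ i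
  index-element = Inverse.strictlyInverseʳ enumeration

  index-injective : ∀ {x y} → index x ≡ index y → x ≈ y
  index-injective {x} {y} eq =
    trans (sym (element-index x)) (trans (reflexive (≡.cong element eq)) (element-index y))

  element-injective : ∀ {i j} → element i ≈ element j → i ≡ j
  element-injective {i} {j} eq =
    ≡.trans (≡.sym (index-element i)) (≡.trans (index-cong eq) (index-element j))

  infix 4 _≟_
  _≟_ : ∀ x y → Dec (x ≈ y)
  x ≟ y = map′ index-injective index-cong (index x Finₚ.≟ index y)

  x*y≈0⇒y≈0 : ∀ {x y} → x ≉ 0# → x * y ≈ 0# → y ≈ 0#
  x*y≈0⇒y≈0 {x} {y} x≉0 xy≈0 = begin
    y                  ≈⟨ *-identityˡ y ⟨
    1# * y             ≈⟨ *-congʳ (proj₁ (proj₂ (invertible x x≉0))) ⟨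
    inv x x≉0 * x * y  ≈⟨ *-assoc _ _ _ ⟩
    inv x x≉0 * (x * y) ≈⟨ *-congˡ xy≈0 ⟩
    inv x x≉0 * 0#     ≈⟨ zeroʳ _ ⟩
    0#                 ∎

  *-cancelˡ-≉0 : ∀ {x y z} → x ≉ 0# → x * y ≈ x * z → y ≈ z
  *-cancelˡ-≉0 {x} {y} {z} x≉0 xy≈xz = begin
    y                   ≈⟨ strip y ⟨
    x⁻¹ * (x * y)       ≈⟨ *-congˡ xy≈xz ⟩
    x⁻¹ * (x * z)       ≈⟨ strip z ⟩
    z                   ∎
    where
    x⁻¹ = inv x x≉0
    strip : ∀ w → x⁻¹ * (x * w) ≈ w
    strip w = trans (sym (*-assoc _ _ _))
      (trans (*-congʳ (proj₁ (proj₂ (invertible x x≉0)))) (*-identityˡ w))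

  x*x⁻¹≈1 : ∀ {x} (x≉0 : x ≉ 0#) → x * inv x x≉0 ≈ 1#
  x*x⁻¹≈1 x≉0 = proj₂ (proj₂ (invertible _ x≉0))

  x*y≉0 : ∀ {x y} → x ≉ 0# → y ≉ 0# → x * y ≉ 0#
  x*y≉0 x≉0 y≉0 xy≈0 = y≉0 (x*y≈0⇒y≈0 x≉0 xy≈0)

  x^n≉0 : ∀ {x} n → x ≉ 0# → x ^ n ≉ 0#
  x^n≉0 zero    x≉0 = 1≉0
  x^n≉0 (suc n) x≉0 = x*y≉0 x≉0 (x^n≉0 n x≉0)

  x≈0⇒x^n≈0 : ∀ {x n} → 0 < n → x ≈ 0# → x ^ n ≈ 0#
  x≈0⇒x^n≈0 {n = suc n} _ x≈0 = trans (*-congʳ x≈0) (zeroˡ _)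

  1^n≈1 : ∀ n → 1# ^ n ≈ 1#
  1^n≈1 zero    = refl
  1^n≈1 (suc n) = trans (*-identityˡ _) (1^n≈1 n)

  ^-swap : ∀ x m n → (x ^ m) ^ n ≈ (x ^ n) ^ m
  ^-swap x m n = begin
    (x ^ m) ^ n    ≈⟨ ^-assocʳ x m n ⟩
    x ^ (m ℕ.* n)  ≡⟨ ≡.cong (x ^_) (ℕₚ.*-comm m n) ⟩
    x ^ (n ℕ.* m)  ≈⟨ ^-assocʳ x n m ⟨
    (x ^ n) ^ m    ∎

  μ-∣ : ∀ {d n x} → d ∣ n → x ^ d ≈ 1# → x ^ n ≈ 1#
  μ-∣ {d} {_} {x} (divides m ≡.refl) x^d≈1 = begin
    x ^ (m ℕ.* d)  ≈⟨ ^-assocʳ x m d ⟨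
    (x ^ m) ^ d    ≈⟨ ^-swap x m d ⟩
    (x ^ d) ^ m    ≈⟨ ^-congˡ m x^d≈1 ⟩
    1# ^ m         ≈⟨ 1^n≈1 m ⟩
    1#             ∎

  -- Polynomial functions

  -- A Horner scheme with arbitrary lower coefficients, ending in the leading coefficient 1. It is a
  -- predicate on functions up to pointwise equality, so linear factors can be divided out through
  -- values alone.
  data Monic : ℕ → (Carrier → Carrier) → Set (c ⊔ ℓ) where
    constant : ∀ {f} → (∀ x → f x ≈ 1#) → Monic 0 f
    horner   : ∀ {n f g} b → Monic n g → (∀ x → f x ≈ b + x * g x) → Monic (suc n) f

  monic-x^k* : ∀ k {n f} → Monic n f → Monic (k ℕ.+ n) (λ x → x ^ k * f x)
  monic-x^k* zero    (constant f≈1)     = constant λ x → trans (*-identityˡ _) (f≈1 x)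
  monic-x^k* zero    (horner b g f≈)    = horner b g λ x → trans (*-identityˡ _) (f≈ x)
  monic-x^k* (suc k) f = horner 0# (monic-x^k* k f) λ x →
    trans (*-assoc _ _ _) (sym (+-identityˡ _))

  monic-b+ : ∀ b {n f} → Monic (suc n) f → Monic (suc n) (λ x → b + f x)
  monic-b+ b (horner b₀ g f≈) = horner (b + b₀) g λ x → trans (+-congˡ (f≈ x)) (sym (+-assoc _ _ _))

  monic-x^n : ∀ n → Monic n (_^ n)
  monic-x^n zero    = constant λ x → refl
  monic-x^n (suc n) = horner 0# (monic-x^n n) λ x → sym (+-identityˡ _)

  x-c+c≈x : ∀ x c → (x - c) + c ≈ x
  x-c+c≈x x c = trans (+-assoc _ _ _) (trans (+-congˡ (-‿inverseˡ c)) (+-identityʳ x))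

  -- Division by x - c with remainder f(c). In Horner form f = b + x h, and dividing h = (x - c) k +
  -- h(c) recursively gives the quotient h(c) + x k.
  monic-quotient : ∀ {n f} → Monic (suc n) f → ∀ c →
                   ∃ λ g → Monic n g × (∀ x → f x ≈ (x - c) * g x + f c)
  monic-quotient {f = f} (horner {g = h} b (constant h≈1) f≈) c =
    (λ _ → 1#) , constant (λ _ → refl) , λ x → begin
      f x                            ≈⟨ f≈ x ⟩
      b + x * h x                    ≈⟨ +-congˡ (*-cong (sym (x-c+c≈x x c)) (trans (h≈1 x) (sym (h≈1 c)))) ⟩
      b + (x - c + c) * h c          ≈⟨ S.solve 4 (λ b d c h → b S.:+ (d S.:+ c) S.:* h S.:=
                                          d S.:* h S.:+ (b S.:+ c S.:* h)) refl b (x - c) c (h c) ⟩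
      (x - c) * h c + (b + c * h c)  ≈⟨ +-cong (*-congˡ (h≈1 c)) (sym (f≈ c)) ⟩
      (x - c) * 1# + f c             ∎
  monic-quotient {f = f} (horner {g = h} b h-monic@(horner _ _ _) f≈) c
    with k , k-monic , h≈ ← monic-quotient h-monic c =
    (λ x → h c + x * k x) , horner (h c) k-monic (λ _ → refl) , λ x → begin
      f x
        ≈⟨ f≈ x ⟩
      b + x * h x
        ≈⟨ +-congˡ (*-congˡ (h≈ x)) ⟩
      b + x * ((x - c) * k x + h c)
        ≈⟨ S.solve 5 (λ b x d k h → b S.:+ x S.:* (d S.:* k S.:+ h) S.:=
             b S.:+ x S.:* (d S.:* k) S.:+ x S.:* h) refl b x (x - c) (k x) (h c) ⟩
      b + x * ((x - c) * k x) + x * h c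
        ≈⟨ +-congˡ (*-congʳ (x-c+c≈x x c)) ⟨
      b + x * ((x - c) * k x) + (x - c + c) * h c
        ≈⟨ S.solve 6 (λ b x d c k h → b S.:+ x S.:* (d S.:* k) S.:+ (d S.:+ c) S.:* h S.:=
             d S.:* (h S.:+ x S.:* k) S.:+ (b S.:+ c S.:* h)) refl b x (x - c) c (k x) (h c) ⟩
      (x - c) * (h c + x * k x) + (b + c * h c)
        ≈⟨ +-congˡ (f≈ c) ⟨
      (x - c) * (h c + x * k x) + f c
        ∎

  -- Dividing by x - t₀ lowers the degree by one, and the other points stay roots of the quotient
  -- because a field has no zero divisors.
  monic-roots≤degree : ∀ {m n f} → Monic n f → (t : Fin m → Carrier) →
                       (∀ {i j} → t i ≈ t j → i ≡ j) → (∀ i → f (t i) ≈ 0#) → m ≤ n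
  monic-roots≤degree {zero}  _ _ _ _ = z≤n
  monic-roots≤degree {suc m} (constant f≈1) t _ root =
    contradiction (trans (sym (f≈1 _)) (root Fin.zero)) 1≉0
  monic-roots≤degree {suc m} f-monic@(horner _ _ _) t t-injective root
    with g , g-monic , f≈ ← monic-quotient f-monic (t Fin.zero) =
    s≤s (monic-roots≤degree g-monic (t ∘ Fin.suc) (Finₚ.suc-injective ∘ t-injective) λ i →
      x*y≈0⇒y≈0
        (λ tᵢ-t₀≈0 → Finₚ.0≢1+n (≡.sym (t-injective (x∙y⁻¹≈ε⇒x≈y _ _ tᵢ-t₀≈0))))
        (trans (sym (trans (+-congˡ (root Fin.zero)) (+-identityʳ _)))
          (trans (sym (f≈ (t (Fin.suc i)))) (root (Fin.suc i)))))

  -- The nonzero elements are enumerated by skipping the index of 0.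
  unit : Fin N → Carrier
  unit = element ∘ punchIn (index 0#)

  unit≉0 : ∀ i → unit i ≉ 0#
  unit≉0 i unit≈0 = Finₚ.punchInᵢ≢i (index 0#) i
    (≡.trans (≡.sym (index-element _)) (index-cong unit≈0))

  unit-injective : ∀ {i j} → unit i ≈ unit j → i ≡ j
  unit-injective eq = Finₚ.punchIn-injective (index 0#) _ _ (element-injective eq)

  -- Otherwise all N units would be roots of a monic polynomial of degree below N. The search over
  -- `Fin N` makes the witness constructive.
  monic-nonRoot : ∀ {n f} → Monic n f → n < N → ∃ λ x → x ≉ 0# × f x ≉ 0#
  monic-nonRoot {f = f} f-monic n<N with Finₚ.any? (λ i → ¬? (f (unit i) ≟ 0#))
  ... | yes (i , fi≉0) = unit i , unit≉0 i , fi≉0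
  ... | no  allRoots   = contradiction
    (monic-roots≤degree f-monic unit unit-injective
      λ i → decidable-stable (f (unit i) ≟ 0#) λ fi≉0 → allRoots (i , fi≉0))
    (ℕₚ.<⇒≱ n<N)

  -- Additive and multiplicative orders

  elementPermutation : (g g⁻¹ : Carrier → Carrier) → (∀ {x y} → x ≈ y → g x ≈ g y) →
    (∀ {x y} → x ≈ y → g⁻¹ x ≈ g⁻¹ y) → (∀ x → g (g⁻¹ x) ≈ x) → (∀ x → g⁻¹ (g x) ≈ x) →
    Permutation (suc N) (suc N)
  elementPermutation g g⁻¹ g-cong g⁻¹-cong gg⁻¹ g⁻¹g =
    permutation (index ∘ g ∘ element) (index ∘ g⁻¹ ∘ element)
      (λ i → ≡.trans (index-cong (trans (g-cong (element-index _)) (gg⁻¹ _))) (index-element i))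
      (λ i → ≡.trans (index-cong (trans (g⁻¹-cong (element-index _)) (g⁻¹g _))) (index-element i))

  -- Translation by 1 permutes the field, so it preserves the sum of all elements; but it also adds
  -- 1 to each of the `suc N` terms.
  order×1≈0 : suc N ×ₙ 1# ≈ 0#
  order×1≈0 = +-identityʳ-unique _ _ (begin
    sum element + suc N ×ₙ 1#   ≈⟨ +-congˡ (sum-replicate (suc N)) ⟨
    sum element + sum (λ (_ : Fin (suc N)) → 1#)  ≈⟨ ∑-distrib-+ element (λ _ → 1#) ⟨
    sum (λ i → element i + 1#)  ≈⟨ sum-cong-≋ (λ i → element-index (element i + 1#)) ⟨
    sum (λ i → element (π ⟨$⟩ʳ i)) ≈⟨ sum-permute element π ⟨
    sum element                 ∎)
    where
    open Sum +-commutativeMonoid using (sum; sum-replicate; ∑-distrib-+; sum-permute; sum-cong-≋)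
    π = elementPermutation (_+ 1#) (_- 1#) +-congʳ +-congʳ (λ x → x-c+c≈x x 1#)
          (λ x → trans (+-assoc _ _ _) (trans (+-congˡ (-‿inverseʳ 1#)) (+-identityʳ x)))

  -- Multiplication by x permutes the units, so their product is unchanged by N extra factors x and
  -- can be cancelled.
  x^N≈1 : ∀ {x} → x ≉ 0# → x ^ N ≈ 1#
  x^N≈1 {x} x≉0 = *-cancelˡ-≉0 (sum≉0 unit unit≉0) (begin
    sum unit * x ^ N                 ≈⟨ *-comm _ _ ⟩
    x ^ N * sum unit                 ≈⟨ *-congʳ (sum-replicate N) ⟨
    sum (λ (_ : Fin N) → x) * sum unit ≈⟨ ∑-distrib-+ (λ _ → x) unit ⟨
    sum (λ i → x * unit i)           ≈⟨ sum-cong-≋ (λ i → x*unit i) ⟩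
    sum (λ i → unit (π₀ ⟨$⟩ʳ i))     ≈⟨ sum-permute unit π₀ ⟨
    sum unit                         ≈⟨ *-identityʳ _ ⟨
    sum unit * 1#                    ∎)
    where
    -- Over the multiplicative monoid, sum is the product.
    open Sum *-commutativeMonoid using (sum; sum-replicate; ∑-distrib-+; sum-permute; sum-cong-≋)
    x⁻¹ = inv x x≉0
    cancel : ∀ {u v} → u * v ≈ 1# → ∀ y → u * (v * y) ≈ y
    cancel uv≈1 y = trans (sym (*-assoc _ _ _)) (trans (*-congʳ uv≈1) (*-identityˡ y))
    π = elementPermutation (x *_) (x⁻¹ *_) *-congˡ *-congˡ
          (cancel (x*x⁻¹≈1 x≉0)) (cancel (proj₁ (proj₂ (invertible x x≉0))))
    -- Multiplication by x fixes 0, so deleting the index of 0 leaves a permutation of the unit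
    -- indices.
    π₀ = remove (index 0#) π
    π-fixes-0 : π ⟨$⟩ʳ index 0# ≡ index 0#
    π-fixes-0 = index-cong (trans (*-congˡ (element-index 0#)) (zeroʳ x))
    x*unit : ∀ i → x * unit i ≈ unit (π₀ ⟨$⟩ʳ i)
    x*unit i = begin
      x * unit i                                                  ≈⟨ element-index _ ⟨
      element (π ⟨$⟩ʳ punchIn (index 0#) i)                       ≡⟨ ≡.cong element (punchIn-permute π (index 0#) i) ⟩
      element (punchIn (π ⟨$⟩ʳ index 0#) (π₀ ⟨$⟩ʳ i))             ≡⟨ ≡.cong (λ j → element (punchIn j (π₀ ⟨$⟩ʳ i))) π-fixes-0 ⟩
      unit (π₀ ⟨$⟩ʳ i)                                            ∎
    sum≉0 : ∀ {n} (t : Fin n → Carrier) → (∀ i → t i ≉ 0#) → sum t ≉ 0#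
    sum≉0 {zero}  t t≉0 = 1≉0
    sum≉0 {suc n} t t≉0 = x*y≉0 (t≉0 Fin.zero) (sum≉0 (t ∘ Fin.suc) (t≉0 ∘ Fin.suc))

  -- Roots of unity

  -- With N = e d and e < N, some unit x is not a root of x^e - 1; then u = x^e differs from 1 and
  -- u^d = x^N = 1.
  nontrivialRootOfUnity : ∀ {d} → 1 < d → d ∣ N → 0 < N → ∃ λ u → u ≉ 1# × u ^ d ≈ 1#
  nontrivialRootOfUnity {d} 1<d (divides zero    N≡0)  0<N = contradiction (≡.sym N≡0) (ℕₚ.<⇒≢ 0<N)
  nontrivialRootOfUnity {d} 1<d (divides (suc e) N≡ed) 0<N
    with x , x≉0 , x^e-1≉0 ← monic-nonRoot (monic-b+ (- 1#) (monic-x^n (suc e)))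
           (≡.subst (suc e <_) (≡.sym N≡ed) (ℕₚ.m<m*n (suc e) d 1<d)) =
    x ^ suc e ,
    (λ x^e≈1 → x^e-1≉0 (trans (+-congˡ x^e≈1) (-‿inverseˡ 1#))) ,
    trans (^-assocʳ x (suc e) d) (trans (^-congʳ x (≡.sym N≡ed)) (x^N≈1 x≉0))

  -- The cofactor of x^m - z in x^(m(n+1)) - z^(n+1). If N = m (n+1) and
  -- z^(n+1) = 1, the product vanishes at all N units, but the cofactor has
  -- degree m n < N, so some unit is a root of x^m - z.
  cofactor : Carrier → ℕ → ℕ → Carrier → Carrier
  cofactor z m zero    x = 1#
  cofactor z m (suc n) x = z ^ suc n + x ^ m * cofactor z m n x

  cofactor-monic : ∀ z m n → Monic (n ℕ.* suc m) (cofactor z (suc m) n)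
  cofactor-monic z m zero    = constant λ _ → refl
  cofactor-monic z m (suc n) = monic-b+ (z ^ suc n) (monic-x^k* (suc m) (cofactor-monic z m n))

  cofactor-factors : ∀ z m n x →
    (x ^ m) ^ suc n ≈ (x ^ m - z) * cofactor z m n x + z ^ suc n
  cofactor-factors z m zero    x = begin
    x ^ m * 1#             ≈⟨ *-congʳ (x-c+c≈x (x ^ m) z) ⟨
    (x ^ m - z + z) * 1#   ≈⟨ distribʳ _ _ _ ⟩
    (x ^ m - z) * 1# + z * 1# ∎
  cofactor-factors z m (suc n) x = begin
    w * w ^ suc n
      ≈⟨ *-congˡ (cofactor-factors z m n x) ⟩
    w * ((w - z) * s + zⁿ)
      ≈⟨ S.solve 4 (λ w d s y → w S.:* (d S.:* s S.:+ y) S.:= w S.:* (d S.:* s) S.:+ w S.:* y) refl w (w - z) s zⁿ ⟩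
    w * ((w - z) * s) + w * zⁿ
      ≈⟨ +-congˡ (*-congʳ (x-c+c≈x w z)) ⟨
    w * ((w - z) * s) + (w - z + z) * zⁿ
      ≈⟨ S.solve 5 (λ w d z s y → w S.:* (d S.:* s) S.:+ (d S.:+ z) S.:* y S.:=
           d S.:* (y S.:+ w S.:* s) S.:+ z S.:* y) refl w (w - z) z s zⁿ ⟩
    (w - z) * (zⁿ + w * s) + z * zⁿ
      ∎
    where
    w = x ^ m
    s = cofactor z m n x
    zⁿ = z ^ suc n

  rootOfUnity⇒power : ∀ m n {z} → N ≡ n ℕ.* m → 0 < N → z ^ n ≈ 1# → ∃ λ x → x ^ m ≈ z
  rootOfUnity⇒power m       zero     N≡ 0<N z^n≈1 = contradiction (≡.sym N≡) (ℕₚ.<⇒≢ 0<N)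
  rootOfUnity⇒power zero    n       N≡ 0<N z^n≈1 =
    contradiction (≡.sym (≡.trans N≡ (ℕₚ.*-zeroʳ n))) (ℕₚ.<⇒≢ 0<N)
  rootOfUnity⇒power (suc m) (suc n) {z} N≡ 0<N z^n≈1
    with x , x≉0 , s≉0 ← monic-nonRoot (cofactor-monic z m n)
           (≡.subst (n ℕ.* suc m <_) (≡.sym N≡) (ℕₚ.m<n+m (n ℕ.* suc m) ℕ.z<s)) =
    x , x∙y⁻¹≈ε⇒x≈y _ _ (x*y≈0⇒y≈0 s≉0 (trans (*-comm _ _) (+-identityˡ-unique _ _ (begin
      (x ^ suc m - z) * s + 1#           ≈⟨ +-congˡ z^n≈1 ⟨
      (x ^ suc m - z) * s + z ^ suc n    ≈⟨ cofactor-factors z (suc m) n x ⟨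
      (x ^ suc m) ^ suc n                ≈⟨ ^-assocʳ x (suc m) (suc n) ⟩
      x ^ (suc m ℕ.* suc n)              ≡⟨ ≡.cong (x ^_) (≡.trans (ℕₚ.*-comm (suc m) (suc n)) (≡.sym N≡)) ⟩
      x ^ N                              ≈⟨ x^N≈1 x≉0 ⟩
      1#                                 ∎))))
    where s = cofactor z (suc m) n _

  consecutivePowers≈1 : ∀ {x k l} → suc k ≡ l → x ^ k ≈ 1# → x ^ l ≈ 1# → x ≈ 1#
  consecutivePowers≈1 {x} ≡.refl x^k≈1 x^l≈1 = trans (sym (trans (*-congˡ x^k≈1) (*-identityʳ x))) x^l≈1

  -- Bézout over the naturals gives a multiple of one exponent that is the successor of a multiple
  -- of the other; both powers are 1, so x is.
  coprime-powers≈1 : ∀ m n {x} → gcd m n ≡ 1 → x ^ m ≈ 1# → x ^ n ≈ 1# → x ≈ 1#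
  coprime-powers≈1 m n {x} gcd≡1 x^m≈1 x^n≈1
    with Bézout.identity (≡.subst (GCD m n) gcd≡1 (gcd-GCD m n))
  ... | Bézout.+- i j 1+jn≡im =
    consecutivePowers≈1 1+jn≡im (μ-∣ (n∣m*n j) x^n≈1) (μ-∣ (n∣m*n i) x^m≈1)
  ... | Bézout.-+ i j 1+im≡jn =
    consecutivePowers≈1 1+im≡jn (μ-∣ (n∣m*n i) x^m≈1) (μ-∣ (n∣m*n j) x^n≈1)

  -- The Frobenius endomorphism

  -- The element p^j · 1 is the j-th power of p · 1, and there are no zero divisors. This extracts
  -- the characteristic from the order of the field.
  p^j×1≈0⇒p×1≈0 : ∀ p j → (p ℕ.^ j) ×ₙ 1# ≈ 0# → p ×ₙ 1# ≈ 0#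
  p^j×1≈0⇒p×1≈0 p zero    eq = contradiction (trans (sym (+-identityʳ 1#)) eq) 1≉0
  p^j×1≈0⇒p×1≈0 p (suc j) eq with p ×ₙ 1# ≟ 0#
  ... | yes p×1≈0 = p×1≈0
  ... | no  p×1≉0 = p^j×1≈0⇒p×1≈0 p j
    (x*y≈0⇒y≈0 p×1≉0 (trans (sym (×1-homo-* p (p ℕ.^ j))) eq))

  module Frobenius {p j} (p-prime : Prime (suc p)) (order≡p^j : suc N ≡ suc p ℕ.^ j) where

    p×1≈0 : suc p ×ₙ 1# ≈ 0#
    p×1≈0 = p^j×1≈0⇒p×1≈0 (suc p) j (trans (×-congˡ (≡.sym order≡p^j)) order×1≈0)

    p∣m⇒m×x≈0 : ∀ {m} → suc p ∣ m → ∀ x → m ×ₙ x ≈ 0#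
    p∣m⇒m×x≈0 (divides k ≡.refl) x = begin
      (k ℕ.* suc p) ×ₙ x             ≈⟨ ×-congʳ (k ℕ.* suc p) (*-identityˡ x) ⟨
      (k ℕ.* suc p) ×ₙ (1# * x)      ≈⟨ ×-assoc-* (k ℕ.* suc p) 1# x ⟨
      (k ℕ.* suc p) ×ₙ 1# * x        ≈⟨ *-congʳ (×1-homo-* k (suc p)) ⟩
      (k ×ₙ 1#) * (suc p ×ₙ 1#) * x  ≈⟨ *-congʳ (*-congˡ p×1≈0) ⟩
      (k ×ₙ 1#) * 0# * x             ≈⟨ *-congʳ (zeroʳ _) ⟩
      0# * x                         ≈⟨ zeroˡ x ⟩
      0#                             ∎

    -- In the binomial expansion the prime `suc p` divides every coefficient but the first and the
    -- last, and its multiples annihilate the field.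
    ^p-homo-+ : ∀ x y → (x + y) ^ suc p ≈ x ^ suc p + y ^ suc p
    ^p-homo-+ x y = begin
      (x + y) ^ suc p                            ≈⟨ Binomial.theorem commutativeSemiring (suc p) x y ⟩
      term Fin.zero + sum (term ∘ Fin.suc)       ≈⟨ +-congˡ (sum-init-last (term ∘ Fin.suc)) ⟩
      term Fin.zero + (sum (λ i → term (Fin.suc (Fin.inject₁ i))) + term (Fin.fromℕ (suc p)))
                                                 ≈⟨ +-cong first (+-cong middle last) ⟩
      y ^ suc p + (0# + x ^ suc p)               ≈⟨ +-congˡ (+-identityˡ _) ⟩
      y ^ suc p + x ^ suc p                      ≈⟨ +-comm _ _ ⟩
      x ^ suc p + y ^ suc p                      ∎
      where
      open Sum +-commutativeMonoid using (sum; sum-replicate-zero; sum-init-last; sum-cong-≋)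
      term : Fin (suc (suc p)) → Carrier
      term = Binomial.binomialTerm commutativeSemiring x y (suc p)
      first : term Fin.zero ≈ y ^ suc p
      first = trans (×-homo-1 _) (*-identityˡ _)
      last : term (Fin.fromℕ (suc p)) ≈ x ^ suc p
      last rewrite Finₚ.toℕ-fromℕ p | nCn≡1 (suc p) | ℕₚ.n∸n≡0 p = trans (×-homo-1 _) (*-identityʳ _)
      middle : sum (λ (i : Fin p) → term (Fin.suc (Fin.inject₁ i))) ≈ 0#
      middle = trans
        (sum-cong-≋ λ i → p∣m⇒m×x≈0
          (prime∣C p-prime (s≤s (≡.subst (_< p) (≡.sym (Finₚ.toℕ-inject₁ i)) (Finₚ.toℕ<n i)))) _)
        (sum-replicate-zero p)

    ^p^k-homo-+ : ∀ k x y → (x + y) ^ (suc p ℕ.^ k) ≈ x ^ (suc p ℕ.^ k) + y ^ (suc p ℕ.^ k)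
    ^p^k-homo-+ zero    x y = trans (*-identityʳ _) (sym (+-cong (*-identityʳ x) (*-identityʳ y)))
    ^p^k-homo-+ (suc k) x y = begin
      (x + y) ^ (suc p ℕ.* pᵏ)               ≈⟨ ^-assocʳ _ (suc p) pᵏ ⟨
      ((x + y) ^ suc p) ^ pᵏ                 ≈⟨ ^-congˡ pᵏ (^p-homo-+ x y) ⟩
      (x ^ suc p + y ^ suc p) ^ pᵏ           ≈⟨ ^p^k-homo-+ k _ _ ⟩
      (x ^ suc p) ^ pᵏ + (y ^ suc p) ^ pᵏ    ≈⟨ +-cong (^-assocʳ x (suc p) pᵏ) (^-assocʳ y (suc p) pᵏ) ⟩
      x ^ (suc p ℕ.* pᵏ) + y ^ (suc p ℕ.* pᵏ) ∎
      where pᵏ = suc p ℕ.^ k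

  -- Polynomial evaluation and bijectivity on a finite field

  eval-cong : ∀ B {x y} → x ≈ y → eval B x ≈ eval B y
  eval-cong []      x≈y = refl
  eval-cong (b ∷ B) x≈y = +-congˡ (*-cong x≈y (eval-cong B x≈y))

  -- An additive q-th power map, being also multiplicative, passes through the Horner form to the
  -- coefficients and the argument.
  eval-^q : ∀ q → 0 < q → (∀ x y → (x + y) ^ q ≈ x ^ q + y ^ q) →
            ∀ B x → eval B x ^ q ≈ eval (B ⁽ q ⁾) (x ^ q)
  -- The split on the exponent is there for 0^q = 0, which fails at exponent 0.
  eval-^q (suc q) 0<q ^q-homo-+ []      x = zeroˡ _
  eval-^q q       0<q ^q-homo-+ (b ∷ B) x = begin
    (b + x * eval B x) ^ q        ≈⟨ ^q-homo-+ b _ ⟩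
    b ^ q + (x * eval B x) ^ q    ≈⟨ +-congˡ (^-distrib-* x _ q) ⟩
    b ^ q + x ^ q * eval B x ^ q  ≈⟨ +-congˡ (*-congˡ (eval-^q q 0<q ^q-homo-+ B x)) ⟩
    b ^ q + x ^ q * eval (B ⁽ q ⁾) (x ^ q) ∎

  -- Pigeonhole: if y were missed, punching out its index would inject `Fin (suc N)` into `Fin N`.
  injective⇒bijective : ∀ {f} → (∀ {x y} → x ≈ y → f x ≈ f y) →
                        (∀ {x y} → f x ≈ f y → x ≈ y) → Bijective _≈_ _≈_ f
  injective⇒bijective {f} f-cong f-injective = f-injective , surjective
    where
    surjective : ∀ y → ∃ λ x → ∀ {z} → z ≈ x → f z ≈ y
    surjective y with Finₚ.any? (λ i → f (element i) ≟ y)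
    ... | yes (i , fi≈y) = element i , λ z≈i → trans (f-cong z≈i) fi≈y
    ... | no  y∉image    = contradiction
      (Finₚ.injective⇒≤ λ eq → element-injective (f-injective
        (index-injective (Finₚ.punchOut-injective (avoids _) (avoids _) eq))))
      ℕₚ.1+n≰n
      where
      avoids : ∀ i → index y ≢ index (f (element i))
      avoids i eq = y∉image (i , index-injective (≡.sym eq))

-- The permutation criterion over a field with q² elements

module PermutationCriterion {c ℓ} (q′ : ℕ) (0<q′ : 0 < q′) (F : FiniteField c ℓ (suc q′ ℕ.^ 2)) where

  open FieldTheory F
  open SetoidReasoning carrierSetoid

  private
    module S = Solver commutativeSemiring

    -- The parameter `q′` is q - 1, which keeps truncated subtraction out of the exponents; `Q` is q
    -- + 1, and `N` = (q + 1)(q - 1) is the order of the multiplicative group.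
    q Q N : ℕ
    q = suc q′
    Q = suc q
    N = ℕ.pred (q ℕ.^ 2)

    N≡Q*q′ : N ≡ Q ℕ.* q′
    N≡Q*q′ = ℕₚ.suc-injective
      (solve 1 (λ n → (con 1 :+ n) :^ 2 := con 1 :+ (con 2 :+ n) :* n) ≡.refl q′)
      where open ℕSolver.+-*-Solver

    0<N : 0 < N
    0<N = ≡.subst (0 <_) (≡.sym N≡Q*q′) (ℕₚ.<-≤-trans 0<q′ (ℕₚ.m≤m+n q′ (q ℕ.* q′)))

  module _ (^q-homo-+ : ∀ x y → (x + y) ^ q ≈ x ^ q + y ^ q)
           (r s : ℕ) (0<s : 0 < s) (s≡r+3 : s % Q ≡ (r ℕ.+ 3) % Q)
           (B : Polynomial) (noRoot : NoRootIn (μ Q) B)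
           (φ-permutes : Permutes (μ Q) (quotientMap q r B noRoot))
           (a : Carrier) (a≉0 : a ≉ 0#)
           where

    private
      f : Carrier → Carrier
      f x = x ^ s * eval B (x ^ q′) * (a * x ^ (3 ℕ.* q′) + a ^ q)

      h : Carrier → Carrier
      h y = eval B y * (a * y ^ 3 + a ^ q)

      -- The order of the group of cubes of μ_{q+1}.
      e : ℕ
      e = _/_ Q (gcd Q 3) ⦃ gcd-nonZero q 3 ⦄

      e*gcd≡Q : e ℕ.* gcd Q 3 ≡ Q
      e*gcd≡Q = m/n*n≡m ⦃ gcd-nonZero q 3 ⦄ (gcd[m,n]∣m Q 3)

    -- The q-th power of f

    x^[3q′]≈[x^q′]^3 : ∀ x → x ^ (3 ℕ.* q′) ≈ (x ^ q′) ^ 3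
    x^[3q′]≈[x^q′]^3 x = trans (^-congʳ x (ℕₚ.*-comm 3 q′)) (sym (^-assocʳ x q′ 3))

    f≈x^s*h : ∀ x → f x ≈ x ^ s * h (x ^ q′)
    f≈x^s*h x = trans (*-congˡ (+-congʳ (*-congˡ (x^[3q′]≈[x^q′]^3 x)))) (*-assoc _ _ _)

    h-cong : ∀ {x y} → x ≈ y → h x ≈ h y
    h-cong x≈y = *-cong (eval-cong B x≈y) (+-congʳ (*-congˡ (^-congˡ 3 x≈y)))

    f-cong : ∀ {x y} → x ≈ y → f x ≈ f y
    f-cong x≈y = *-cong (*-cong (^-congˡ s x≈y) (eval-cong B (^-congˡ q′ x≈y)))
      (+-congʳ (*-congˡ (^-congˡ (3 ℕ.* q′) x≈y)))

    x≈0⇒f≈0 : ∀ {x} → x ≈ 0# → f x ≈ 0#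
    x≈0⇒f≈0 x≈0 = trans (*-congʳ (trans (*-congʳ (x≈0⇒x^n≈0 0<s x≈0)) (zeroˡ _))) (zeroˡ _)

    x^q′∈μ : ∀ {x} → x ≉ 0# → (x ^ q′) ^ Q ≈ 1#
    x^q′∈μ {x} x≉0 = begin
      (x ^ q′) ^ Q    ≈⟨ ^-assocʳ x q′ Q ⟩
      x ^ (q′ ℕ.* Q)  ≡⟨ ≡.cong (x ^_) (≡.trans (ℕₚ.*-comm q′ Q) (≡.sym N≡Q*q′)) ⟩
      x ^ N           ≈⟨ x^N≈1 x≉0 ⟩
      1#              ∎

    a^q^q≈a : (a ^ q) ^ q ≈ a
    a^q^q≈a = begin
      (a ^ q) ^ q    ≈⟨ ^-assocʳ a q q ⟩
      -- The numeral power q² unfolds to q (q · 1), so this form of the exponent is `suc N` and the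
      -- power unfolds to `a * a ^ N`.
      a ^ (q ℕ.* q)  ≡⟨ ≡.cong (λ n → a ^ (q ℕ.* n)) (ℕₚ.*-identityʳ q) ⟨
      a * a ^ N      ≈⟨ *-congˡ (x^N≈1 a≉0) ⟩
      a * 1#         ≈⟨ *-identityʳ a ⟩
      a              ∎

    ^-cong-% : ∀ m n {x} → x ^ Q ≈ 1# → m % Q ≡ n % Q → x ^ m ≈ x ^ n
    ^-cong-% m n {x} x^Q≈1 m≡n =
      trans (reduce m) (trans (^-congʳ x m≡n) (sym (reduce n)))
      where
      reduce : ∀ m → x ^ m ≈ x ^ (m % Q)
      reduce m = begin
        x ^ m                               ≡⟨ ≡.cong (x ^_) (m≡m%n+[m/n]*n m Q) ⟩
        x ^ (m % Q ℕ.+ m / Q ℕ.* Q)         ≈⟨ ^-homo-* x (m % Q) (m / Q ℕ.* Q) ⟩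
        x ^ (m % Q) * x ^ (m / Q ℕ.* Q)     ≈⟨ *-congˡ (μ-∣ (n∣m*n (m / Q)) x^Q≈1) ⟩
        x ^ (m % Q) * 1#                    ≈⟨ *-identityʳ _ ⟩
        x ^ (m % Q)                         ∎

    f^q≈f*φ : ∀ {x} (x≉0 : x ≉ 0#) →
              f x ^ q ≈ f x * quotientMap q r B noRoot (x ^ q′ , x^q′∈μ x≉0)
    f^q≈f*φ {x} x≉0 = begin
      (x ^ s * b * (a * x ^ (3 ℕ.* q′) + a ^ q)) ^ q
        ≈⟨ ^-distrib-* _ _ q ⟩
      (x ^ s * b) ^ q * (a * x ^ (3 ℕ.* q′) + a ^ q) ^ q
        ≈⟨ *-cong (trans (^-distrib-* _ _ q) (*-cong x^s^q b^q)) cubic^q ⟩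
      (x ^ s * (y ^ r * y ^ 3)) * b′ * (a ^ q * y⁻¹ ^ 3 + a)
        ≈⟨ S.solve 7 (λ xs yr y3 b′ aq i3 a →
             xs S.:* (yr S.:* y3) S.:* b′ S.:* (aq S.:* i3 S.:+ a) S.:=
             xs S.:* yr S.:* b′ S.:* (a S.:* y3 S.:+ aq S.:* (y3 S.:* i3)))
             refl (x ^ s) (y ^ r) (y ^ 3) b′ (a ^ q) (y⁻¹ ^ 3) a ⟩
      x ^ s * y ^ r * b′ * (a * y ^ 3 + a ^ q * (y ^ 3 * y⁻¹ ^ 3))
        ≈⟨ *-congˡ (+-congˡ (*-congˡ y³y⁻³)) ⟩
      x ^ s * y ^ r * b′ * (a * y ^ 3 + a ^ q * 1#)
        ≈⟨ *-congˡ (+-cong (*-congˡ (sym (x^[3q′]≈[x^q′]^3 x))) (*-identityʳ _)) ⟩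
      x ^ s * y ^ r * b′ * (a * x ^ (3 ℕ.* q′) + a ^ q)
        -- Inserting B(y)/B(y) restores the factor B(y) of f and supplies the denominator of φ(y).
        ≈⟨ *-identityˡ _ ⟨
      1# * (x ^ s * y ^ r * b′ * (a * x ^ (3 ℕ.* q′) + a ^ q))
        ≈⟨ *-congʳ (x*x⁻¹≈1 (noRoot y∈μ)) ⟨
      b * b⁻¹ * (x ^ s * y ^ r * b′ * (a * x ^ (3 ℕ.* q′) + a ^ q))
        ≈⟨ S.solve 6 (λ b b⁻¹ xs yr b′ t →
             b S.:* b⁻¹ S.:* (xs S.:* yr S.:* b′ S.:* t) S.:=
             xs S.:* b S.:* t S.:* (yr S.:* b′ S.:* b⁻¹))
             refl b b⁻¹ (x ^ s) (y ^ r) b′ (a * x ^ (3 ℕ.* q′) + a ^ q) ⟩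
      f x * (y ^ r * b′ * b⁻¹)
        ∎
      where
      y   = x ^ q′
      y∈μ = x^q′∈μ x≉0
      y≉0 = μ⇒≉0 {q} y∈μ
      y⁻¹ = inv y y≉0
      b   = eval B y
      b⁻¹ = inv b (noRoot y∈μ)
      b′  = eval (B ⁽ q ⁾) y⁻¹

      y^q≈y⁻¹ : y ^ q ≈ y⁻¹
      y^q≈y⁻¹ = *-cancelˡ-≉0 y≉0 (trans y∈μ (sym (x*x⁻¹≈1 y≉0)))

      x^s^q : (x ^ s) ^ q ≈ x ^ s * (y ^ r * y ^ 3)
      x^s^q = begin
        (x ^ s) ^ q            ≈⟨ ^-swap x s q ⟩
        -- Since q = `suc q′`, the power `x ^ q` unfolds to `x * y`.
        (x * y) ^ s            ≈⟨ ^-distrib-* x y s ⟩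
        x ^ s * y ^ s          ≈⟨ *-congˡ (^-cong-% s (r ℕ.+ 3) y∈μ s≡r+3) ⟩
        x ^ s * y ^ (r ℕ.+ 3)  ≈⟨ *-congˡ (^-homo-* y r 3) ⟩
        x ^ s * (y ^ r * y ^ 3) ∎

      b^q : b ^ q ≈ b′
      b^q = trans (eval-^q q ℕ.z<s ^q-homo-+ B y) (eval-cong (B ⁽ q ⁾) y^q≈y⁻¹)

      cubic^q : (a * x ^ (3 ℕ.* q′) + a ^ q) ^ q ≈ a ^ q * y⁻¹ ^ 3 + a
      cubic^q = begin
        (a * x ^ (3 ℕ.* q′) + a ^ q) ^ q            ≈⟨ ^q-homo-+ _ _ ⟩
        (a * x ^ (3 ℕ.* q′)) ^ q + (a ^ q) ^ q      ≈⟨ +-cong (^-distrib-* _ _ q) a^q^q≈a ⟩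
        a ^ q * (x ^ (3 ℕ.* q′)) ^ q + a            ≈⟨ +-congʳ (*-congˡ (^-congˡ q (x^[3q′]≈[x^q′]^3 x))) ⟩
        a ^ q * (y ^ 3) ^ q + a                     ≈⟨ +-congʳ (*-congˡ (^-swap y 3 q)) ⟩
        a ^ q * (y ^ q) ^ 3 + a                     ≈⟨ +-congʳ (*-congˡ (^-congˡ 3 y^q≈y⁻¹)) ⟩
        a ^ q * y⁻¹ ^ 3 + a                         ∎

      y³y⁻³ : y ^ 3 * y⁻¹ ^ 3 ≈ 1#
      y³y⁻³ = trans (sym (^-distrib-* y y⁻¹ 3)) (trans (^-congˡ 3 (x*x⁻¹≈1 y≉0)) (1^n≈1 3))

    -- Sufficiency: injectivity of f

    -- A root y would satisfy y³ = -a^(q-1). As 3 is a multiple of gcd(q+1, 3), 3e is a multiple of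
    -- q + 1, so y^(3e) = 1 and -a^(q-1) would lie in μ_e.
    cubic≉0 : - (a ^ q′) ∉ μ e → ∀ {y} → y ^ Q ≈ 1# → a * y ^ 3 + a ^ q ≉ 0#
    cubic≉0 -a^q′∉μ {y} y∈μ cubic≈0 with divides m 3≡m*g ← gcd[m,n]∣n Q 3 =
      -a^q′∉μ (begin
        (- (a ^ q′)) ^ e         ≈⟨ ^-congˡ e (+-inverseˡ-unique _ _ y³+a^q′≈0) ⟨
        (y ^ 3) ^ e              ≈⟨ ^-assocʳ y 3 e ⟩
        y ^ (3 ℕ.* e)            ≈⟨ μ-∣ (divides m 3*e≡m*Q) y∈μ ⟩
        1#                       ∎)
      where
      3*e≡m*Q : 3 ℕ.* e ≡ m ℕ.* Q
      3*e≡m*Q = ≡.trans (≡.cong (ℕ._* e) 3≡m*g) (≡.trans (ℕₚ.*-assoc m (gcd Q 3) e)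
        (≡.cong (m ℕ.*_) (≡.trans (ℕₚ.*-comm (gcd Q 3) e) e*gcd≡Q)))
      y³+a^q′≈0 : y ^ 3 + a ^ q′ ≈ 0#
      y³+a^q′≈0 = x*y≈0⇒y≈0 a≉0 (trans (distribˡ _ _ _) cubic≈0)

    f-injective : gcd s q′ ≡ 1 → - (a ^ q′) ∉ μ e → ∀ {x₁ x₂} → f x₁ ≈ f x₂ → x₁ ≈ x₂
    f-injective gcd≡1 -a^q′∉μ {x₁} {x₂} f₁≈f₂ = cases (x₁ ≟ 0#) (x₂ ≟ 0#)
      where
      h≉0 : ∀ {x} → x ≉ 0# → h (x ^ q′) ≉ 0#
      h≉0 x≉0 = x*y≉0 (noRoot (x^q′∈μ x≉0)) (cubic≉0 -a^q′∉μ (x^q′∈μ x≉0))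

      f≉0 : ∀ {x} → x ≉ 0# → f x ≉ 0#
      f≉0 {x} x≉0 f≈0 = x*y≉0 (x^n≉0 s x≉0) (h≉0 x≉0) (trans (sym (f≈x^s*h x)) f≈0)

      nonzero : x₁ ≉ 0# → x₂ ≉ 0# → x₁ ≈ x₂
      nonzero x₁≉0 x₂≉0 = begin
        x₁                ≈⟨ *-identityʳ x₁ ⟨
        x₁ * 1#           ≈⟨ *-congˡ (x*x⁻¹≈1 x₂≉0) ⟨
        x₁ * (x₂ * x₂⁻¹)  ≈⟨ S.solve 3 (λ u v w → u S.:* (v S.:* w) S.:= v S.:* (u S.:* w)) refl x₁ x₂ x₂⁻¹ ⟩
        -- The ratio x₁/x₂ has both s-th and (q-1)-th power 1, hence is 1 by coprimality.
        x₂ * (x₁ * x₂⁻¹)  ≈⟨ *-congˡ (coprime-powers≈1 s q′ gcd≡1 (ratio^≈1 s x₁^s≈x₂^s) (ratio^≈1 q′ y₁≈y₂)) ⟩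
        x₂ * 1#           ≈⟨ *-identityʳ x₂ ⟩
        x₂                ∎
        where
        x₂⁻¹ = inv x₂ x₂≉0

        ratio^≈1 : ∀ n → x₁ ^ n ≈ x₂ ^ n → (x₁ * x₂⁻¹) ^ n ≈ 1#
        ratio^≈1 n eq = begin
          (x₁ * x₂⁻¹) ^ n    ≈⟨ ^-distrib-* _ _ n ⟩
          x₁ ^ n * x₂⁻¹ ^ n  ≈⟨ *-congʳ eq ⟩
          x₂ ^ n * x₂⁻¹ ^ n  ≈⟨ ^-distrib-* _ _ n ⟨
          (x₂ * x₂⁻¹) ^ n    ≈⟨ ^-congˡ n (x*x⁻¹≈1 x₂≉0) ⟩
          1# ^ n             ≈⟨ 1^n≈1 n ⟩
          1#                 ∎

        y₁≈y₂ : x₁ ^ q′ ≈ x₂ ^ q′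
        -- Cancelling the common nonzero value f(x₁) = f(x₂) from f(x)^q = f(x) φ(y) leaves φ(y₁) =
        -- φ(y₂).
        y₁≈y₂ = proj₁ (proj₂ φ-permutes) {_ , x^q′∈μ x₁≉0} {_ , x^q′∈μ x₂≉0} (*-cancelˡ-≉0 (f≉0 x₁≉0)
          (trans (sym (f^q≈f*φ x₁≉0)) (trans (^-congˡ q f₁≈f₂)
            (trans (f^q≈f*φ x₂≉0) (*-congʳ (sym f₁≈f₂))))))

        x₁^s≈x₂^s : x₁ ^ s ≈ x₂ ^ s
        x₁^s≈x₂^s = *-cancelˡ-≉0 (h≉0 x₁≉0) (begin
          h (x₁ ^ q′) * x₁ ^ s  ≈⟨ *-comm _ _ ⟩
          x₁ ^ s * h (x₁ ^ q′)  ≈⟨ f≈x^s*h x₁ ⟨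
          f x₁                  ≈⟨ f₁≈f₂ ⟩
          f x₂                  ≈⟨ f≈x^s*h x₂ ⟩
          x₂ ^ s * h (x₂ ^ q′)  ≈⟨ *-comm _ _ ⟩
          h (x₂ ^ q′) * x₂ ^ s  ≈⟨ *-congʳ (h-cong y₁≈y₂) ⟨
          h (x₁ ^ q′) * x₂ ^ s  ∎)

      cases : Dec (x₁ ≈ 0#) → Dec (x₂ ≈ 0#) → x₁ ≈ x₂
      cases (yes x₁≈0) (yes x₂≈0) = trans x₁≈0 (sym x₂≈0)
      cases (yes x₁≈0) (no  x₂≉0) = contradiction (trans (sym f₁≈f₂) (x≈0⇒f≈0 x₁≈0)) (f≉0 x₂≉0)
      cases (no  x₁≉0) (yes x₂≈0) = contradiction (trans f₁≈f₂ (x≈0⇒f≈0 x₂≈0)) (f≉0 x₁≉0)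
      cases (no  x₁≉0) (no  x₂≉0) = nonzero x₁≉0 x₂≉0

    -- Necessity of the two conditions

    injective⇒gcd≡1 : (∀ {x₁ x₂} → f x₁ ≈ f x₂ → x₁ ≈ x₂) → gcd s q′ ≡ 1
    injective⇒gcd≡1 f-inj = decidable-stable (gcd s q′ ℕ.≟ 1) λ gcd≢1 →
      -- As s is positive the gcd is nonzero, so being different from 1 it exceeds 1.
      let 1<gcd = ℕₚ.≤∧≢⇒< (ℕₚ.n≢0⇒n>0 (gcd[m,n]≢0 s q′ (inj₁ (ℕₚ.m<n⇒n≢0 0<s)))) (gcd≢1 ∘ ≡.sym)
          u , u≉1 , u^gcd≈1 = nontrivialRootOfUnity 1<gcd
            (∣-trans (gcd[m,n]∣n s q′) (divides Q N≡Q*q′)) 0<N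
          u^s≈1  = μ-∣ (gcd[m,n]∣m s q′) u^gcd≈1
          u^q′≈1 = μ-∣ (gcd[m,n]∣n s q′) u^gcd≈1
      in u≉1 (f-inj (begin
        f u                   ≈⟨ f≈x^s*h u ⟩
        u ^ s * h (u ^ q′)    ≈⟨ *-cong (trans u^s≈1 (sym (1^n≈1 s))) (h-cong (trans u^q′≈1 (sym (1^n≈1 q′)))) ⟩
        1# ^ s * h (1# ^ q′)  ≈⟨ f≈x^s*h 1# ⟨
        f 1#                  ∎))

    -- If 3 divides q + 1, then N = e · 3(q-1) and an e-th root of unity is directly a 3(q-1)-th
    -- power. Otherwise 3 is invertible modulo q + 1, so z has a cube root in μ_{q+1}, which is
    -- itself a (q-1)-th power.
    μₑ⇒power : ∀ {z} → z ^ e ≈ 1# → ∃ λ x → x ^ (3 ℕ.* q′) ≈ z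
    μₑ⇒power {z} z^e≈1 = cases (Q % 3) (Q / 3) (m%n<n Q 3) (m≡m%n+[m/n]*n Q 3)
      where
      z^Q≈1 : z ^ Q ≈ 1#
      z^Q≈1 = μ-∣ (divides (gcd Q 3) (≡.trans (≡.sym e*gcd≡Q) (ℕₚ.*-comm e _))) z^e≈1

      -- z^j is then a cube root of z in μ_{q+1}.
      invertible-3 : ∀ j i → j ℕ.* 3 ≡ 1 ℕ.+ i ℕ.* Q → ∃ λ x → x ^ (3 ℕ.* q′) ≈ z
      invertible-3 j i 3j≡1+iQ
        with x , x^q′≈z^j ← rootOfUnity⇒power q′ Q N≡Q*q′ 0<N (trans (^-swap z j Q) (trans (^-congˡ j z^Q≈1) (1^n≈1 j))) =
        x , (begin
          x ^ (3 ℕ.* q′)    ≈⟨ x^[3q′]≈[x^q′]^3 x ⟩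
          (x ^ q′) ^ 3      ≈⟨ ^-congˡ 3 x^q′≈z^j ⟩
          (z ^ j) ^ 3       ≈⟨ ^-assocʳ z j 3 ⟩
          z ^ (j ℕ.* 3)     ≡⟨ ≡.cong (z ^_) 3j≡1+iQ ⟩
          z * z ^ (i ℕ.* Q) ≈⟨ *-congˡ (μ-∣ (n∣m*n i) z^Q≈1) ⟩
          z * 1#            ≈⟨ *-identityʳ z ⟩
          z                 ∎)

      cases : ∀ m t → m < 3 → Q ≡ m ℕ.+ t ℕ.* 3 → ∃ λ x → x ^ (3 ℕ.* q′) ≈ z
      cases 0 t _ Q≡3t = rootOfUnity⇒power (3 ℕ.* q′) e
        (≡.trans N≡Q*q′ (≡.trans (≡.cong (ℕ._* q′) (≡.sym e*3≡Q)) (ℕₚ.*-assoc e 3 q′))) 0<N z^e≈1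
        where
        gcd≡3 : gcd Q 3 ≡ 3
        gcd≡3 = ∣-antisym (gcd[m,n]∣n Q 3) (gcd-greatest (divides t Q≡3t) ∣-refl)
        e*3≡Q : e ℕ.* 3 ≡ Q
        e*3≡Q = ≡.trans (≡.cong (e ℕ.*_) (≡.sym gcd≡3)) e*gcd≡Q
      -- For q + 1 = 1 + 3t the inverse of 3 is 1 + 2t, because 3(1 + 2t) = 1 + 2(q + 1).
      cases 1 t _ Q≡1+3t = invertible-3 (1 ℕ.+ 2 ℕ.* t) 2
        (≡.trans (solve 1 (λ t → (con 1 :+ con 2 :* t) :* con 3 := con 1 :+ con 2 :* (con 1 :+ t :* con 3)) ≡.refl t)
          (≡.cong (λ n → 1 ℕ.+ 2 ℕ.* n) (≡.sym Q≡1+3t)))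
        where open ℕSolver.+-*-Solver
      -- For q + 1 = 2 + 3t the inverse of 3 is 1 + t, because 3(1 + t) = 1 + (q + 1).
      cases 2 t _ Q≡2+3t = invertible-3 (1 ℕ.+ t) 1
        (≡.cong suc (≡.trans (≡.sym Q≡2+3t) (≡.sym (ℕₚ.*-identityˡ Q))))
      cases (suc (suc (suc _))) _ (s≤s (s≤s (s≤s ()))) _

    -- An x with x^(3(q-1)) = -a^(q-1) annihilates the cubic factor, so f(x) = 0 = f(0). Injectivity
    -- forces x = 0, and then a^(q-1) = 0 contradicts a ≠ 0.
    injective⇒∉μ : (∀ {x₁ x₂} → f x₁ ≈ f x₂ → x₁ ≈ x₂) → - (a ^ q′) ∉ μ e
    injective⇒∉μ f-inj -a^q′∈μ with x , x^[3q′]≈ ← μₑ⇒power -a^q′∈μ =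
      x^n≉0 q′ a≉0 (begin
        a ^ q′                      ≈⟨ +-identityʳ _ ⟨
        a ^ q′ + 0#                 ≈⟨ +-congˡ (x≈0⇒x^n≈0 0<3q′ x≈0) ⟨
        a ^ q′ + x ^ (3 ℕ.* q′)     ≈⟨ +-congˡ x^[3q′]≈ ⟩
        a ^ q′ + - (a ^ q′)         ≈⟨ -‿inverseʳ _ ⟩
        0#                          ∎)
      where
      0<3q′ : 0 < 3 ℕ.* q′
      0<3q′ = ℕₚ.<-≤-trans 0<q′ (ℕₚ.m≤m+n q′ _)
      cubic≈0 : a * x ^ (3 ℕ.* q′) + a ^ q ≈ 0#
      cubic≈0 = begin
        a * x ^ (3 ℕ.* q′) + a * a ^ q′  ≈⟨ distribˡ a _ _ ⟨
        a * (x ^ (3 ℕ.* q′) + a ^ q′)    ≈⟨ *-congˡ (+-congʳ x^[3q′]≈) ⟩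
        a * (- (a ^ q′) + a ^ q′)        ≈⟨ *-congˡ (-‿inverseˡ _) ⟩
        a * 0#                           ≈⟨ zeroʳ a ⟩
        0#                               ∎
      x≈0 : x ≈ 0#
      x≈0 = f-inj (trans (trans (*-congˡ cubic≈0) (zeroʳ _)) (sym (x≈0⇒f≈0 refl)))

    criterion : Bijective _≈_ _≈_ f ⇔ (gcd s q′ ≡ 1 × - (a ^ q′) ∉ μ e)
    criterion = mk⇔
      (λ (f-inj , _) → injective⇒gcd≡1 f-inj , injective⇒∉μ f-inj)
      (λ (gcd≡1 , -a^q′∉μ) → injective⇒bijective f-cong (f-injective gcd≡1 -a^q′∉μ))

-- Prime powers, the subfield and the resulting theorem

theorem3p10 : ∀ {c₁ ℓ₁ c₂ ℓ₂} (p k q r s : ℕ) → Prime p → 0 < k → q ≡ p ℕ.^ k →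
    0 < r → 0 < s → s % suc q ≡ (r ℕ.+ 3) % suc q →
    (Fq : FiniteField c₁ ℓ₁ q) (Fq² : FiniteField c₂ ℓ₂ (q ℕ.^ 2)) →
    let open FiniteField Fq² in
    (ι : FiniteField.Carrier Fq → Carrier) →
    RingMorphisms.IsRingMonomorphism (FiniteField.rawRing Fq) rawRing ι →
    (B : Polynomial) (noRoot : NoRootIn (μ (suc q)) B) →
    Permutes (μ (suc q)) (quotientMap q r B noRoot) →
    (a : Carrier) → (∀ b → ι b ≉ a) →
    Bijective _≈_ _≈_ (λ x → x ^ s * eval B (x ^ (q ∸ 1)) * (a * x ^ (3 ℕ.* (q ∸ 1)) + a ^ q))
    ⇔ (gcd s (q ∸ 1) ≡ 1 × - (a ^ (q ∸ 1)) ∉ μ (_/_ (suc q) (gcd (suc q) 3) ⦃ gcd-nonZero q 3 ⦄))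
theorem3p10 zero    k q r s p-prime = contradiction p-prime ¬prime[0]
theorem3p10 (suc p) k zero r s p-prime 0<k q≡p^k =
  contradiction (≡.sym q≡p^k) (ℕ.≢-nonZero⁻¹ (suc p ℕ.^ k) ⦃ ℕₚ.m^n≢0 (suc p) k ⦄)
theorem3p10 (suc p) k (suc q′) r s p-prime 0<k q≡p^k 0<r 0<s s≡r+3 Fq Fq² ι ι-mono B noRoot φ-permutes a a∉Fq =
  criterion ^q-homo-+ r s 0<s s≡r+3 B noRoot φ-permutes a a≉0
  where
  open FieldTheory Fq²
  open RingMorphisms.IsRingMonomorphism ι-mono using (0#-homo)

  -- A prime exceeds 1 and k is positive, so q > 1.
  0<q′ : 0 < q′
  0<q′ = ℕ.s<s⁻¹ (≡.subst (1 <_) (≡.sym q≡p^k) (1<m^n k 0<k))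
    where
    instance _ = prime⇒nonTrivial p-prime
    1<m^n : ∀ k → 0 < k → 1 < suc p ℕ.^ k
    1<m^n (suc k) _ = ℕₚ.<-≤-trans (ℕ.nonTrivial⇒n>1 (suc p))
      (ℕₚ.m≤m*n (suc p) (suc p ℕ.^ k) ⦃ ℕₚ.m^n≢0 (suc p) k ⦄)

  open PermutationCriterion q′ 0<q′ Fq² using (criterion)
  -- The field has q² = p^(2k) elements.
  open Frobenius {j = k ℕ.* 2} p-prime
    (≡.trans (≡.cong (ℕ._^ 2) q≡p^k) (ℕₚ.^-*-assoc (suc p) k 2)) using (^p^k-homo-+)

  ^q-homo-+ : ∀ x y → (x + y) ^ suc q′ ≈ x ^ suc q′ + y ^ suc q′
  ^q-homo-+ = ≡.subst (λ n → ∀ x y → (x + y) ^ n ≈ x ^ n + y ^ n) (≡.sym q≡p^k) (^p^k-homo-+ k)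

  -- The subfield contains 0 = ι(0), so an element outside it is nonzero.
  a≉0 : a ≉ 0#
  a≉0 a≈0 = a∉Fq (FiniteField.0# Fq) (trans 0#-homo (sym a≈0))
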